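{- Let $(\mathcal{R},\leq,r)$ be a \textbf{wA2}-space such that $\mathcal{AR}$ is countable (so $\mathcal{R}$ is a Polish space under the first-difference metric). Then every analytic subset of $\mathcal{R}$ is Kastanas Ramsey.
   Context: $\mathcal{R}$ is a nonempty set, $\leq$ a quasi-order on $\mathcal{R}$, $\mathcal{AR}$ a set and $r:\mathcal{R}\times\omega\to\mathcal{AR}$; write $r_n(A):=r(A,n)$, $\mathcal{AR}_n:=\{r_n(A):A\in\mathcal{R}\}$. Axiom A1: (1) $r_0(A)=\emptyset$ for all $A$; (2) $A\neq B$ implies $r_n(A)\neq r_n(B)$ for some $n$; (3) $r_n(A)=r_m(B)$ implies $n=m$ and $r_k(A)=r_k(B)$ for $k<n$. $\mathrm{lh}(a)$ is the unique $n$ with $a\in\mathcal{AR}_n$; $a\sqsubseteq b$ means $a=r_m(A),b=r_n(A)$ for some $A$ and $m\le n$. Axiom wA2: a quasi-order $\leq_{\mathrm{fin}}$ on $\mathcal{AR}$ with (w1) $\{a:a\leq_{\mathrm{fin}}b\}$ countable for all $b$; (2) $A\le B$ iff $\forall n\exists m\,r_n(A)\leq_{\mathrm{fin}}r_m(B)$; (3) $a\sqsubseteq b$, $b\leq_{\mathrm{fin}}c$ imply $\exists d\sqsubseteq c$ with $a\leq_{\mathrm{fin}}d$. $[a,A]:=\{B\le A:\exists n\,r_n(B)=a\}$, $[n,A]:=[r_n(A),A]$, $\mathrm{depth}_B(a):=\min\{n:a\leq_{\mathrm{fin}}r_n(B)\}$ (or $\infty$), $\mathcal{AR}{\upharpoonright}A:=\{a:\exists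 n\,a\leq_{\mathrm{fin}}r_n(A)\}$, $r_n[a,A]:=\{b\in\mathcal{AR}{\upharpoonright}A:a\sqsubseteq b,\mathrm{lh}(b)=n\}$. Axiom A3: (1) if $\mathrm{depth}_B(a)<\infty$ then $[a,A]\ne\emptyset$ for all $A\in[\mathrm{depth}_B(a),B]$; (2) if $A\le B$ and $[a,A]\ne\emptyset$ there is $A'\in[\mathrm{depth}_B(a),B]$ with $\emptyset\ne[a,A']\subseteq[a,A]$. Identifying $A\in\mathcal{R}$ with $(r_n(A))_n\in\mathcal{AR}^{\mathbb N}$, a \textbf{wA2}-space is such a triple satisfying A1, wA2, A3 with $\mathcal{R}$ closed in $\mathcal{AR}^{\mathbb N}$ (product of discrete spaces). The topology used is that of the first-difference metric $d(A,B)=2^{ -n}$, $n$ least with $r_n(A)\ne r_n(B)$. Kastanas game $K[a,A]$ ($a\in\mathcal{AR}{\upharpoonright}A$): with $a_0=a$, $B_{ -1}=A$, in round $n$ player I plays $A_n\in[a_n,B_{n-1}]$, then II plays $a_{n+1}\in r_{\mathrm{lh}(a_n)+1}[a_n,A_n]$ and $B_n\in[a_{n+1},A_n]$; the outcome is the $B\in\mathcal{R}$ with $r_{\mathrm{lh}(a)+n}(B)=a_n$ for all $n$. $\mathcal{X}\subseteq\mathcal{R}$ is Kastanas Ramsey if for all $A$ and $a\in\mathcal{AR}{\upharpoonright}A$ there is $B\in[a,A]$ such that I has a strategy in $K[a,B]$ ensuring the outcome is in $\mathcal{X}^c$, or II has a strategy in $K[a,B]$ ensuring the outcome is in $\mathcal{X}$.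 -}

module Defs where

open import Level using (0ℓ)
open import Data.Nat using (ℕ; zero; suc; _+_; _<_; _≤_)
open import Data.List using (List; applyUpTo)
open import Data.Product using (Σ; ∃; ∃-syntax; _×_; _,_)
open import Data.Sum using (_⊎_)
open import Relation.Nullary using (¬_)
open import Relation.Binary.PropositionalEquality using (_≡_; _≢_)
open import Function.Bundles using (_⇔_)

record WA2Space : Set₁ where
  field
    R      : Set
    AR     : Set
    _≤R_   : R → R → Set
    r      : R → ℕ → AR
    _≤fin_ : AR → AR → Set
    ∅AR    : AR

  InAR : ℕ → AR → Set
  InAR n a = ∃[ A ] r A n ≡ a

  _⊑_ : AR → AR → Set
  a ⊑ b = ∃[ A ] ∃[ m ] ∃[ n ] (m ≤ n × r A m ≡ a × r A n ≡ b)

  Cube : AR → R → R → Set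
  Cube a A B = B ≤R A × ∃[ n ] r B n ≡ a

  CubeN : ℕ → R → R → Set
  CubeN n A = Cube (r A n) A

  ARr : R → AR → Set
  ARr A a = ∃[ n ] a ≤fin r A n

  IsDepth : R → AR → ℕ → Set
  IsDepth B a n = a ≤fin r B n × (∀ m → m < n → ¬ (a ≤fin r B m))

  rCube : ℕ → AR → R → AR → Set
  rCube n a A b = ARr A b × a ⊑ b × InAR n b

  field
    nonempty   : R
    ≤R-refl    : ∀ A → A ≤R A
    ≤R-trans   : ∀ {A B C} → A ≤R B → B ≤R C → A ≤R C
    A1-1       : ∀ A → r A 0 ≡ ∅AR
    A1-2       : ∀ A B → A ≢ B → ∃[ n ] r A n ≢ r B n
    A1-3       : ∀ A B n m → r A n ≡ r B m →
                 n ≡ m × (∀ k → k < n → r A k ≡ r B k)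
    ≤fin-refl  : ∀ a → a ≤fin a
    ≤fin-trans : ∀ {a b c} → a ≤fin b → b ≤fin c → a ≤fin c
    wA2-1      : ∀ b → Σ (ℕ → AR) λ f → ((∀ (n : ℕ) → f n ≤fin b) ×
                              (∀ a → a ≤fin b → ∃[ n ] f n ≡ a))
    wA2-2      : ∀ A B → (A ≤R B) ⇔ (∀ n → ∃[ m ] r A n ≤fin r B m)
    wA2-3      : ∀ a b c → a ⊑ b → b ≤fin c → ∃[ d ] (d ⊑ c × a ≤fin d)
    A3-1       : ∀ B a n → IsDepth B a n →
                 ∀ A → CubeN n B A → ∃[ C ] Cube a A C
    A3-2       : ∀ A B a → A ≤R B → (∃[ C ] Cube a A C) →
                 ∀ n → IsDepth B a n →
                 ∃[ A' ] (CubeN n B A' × (∃[ C ] Cube a A' C) ×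
                          (∀ C → Cube a A' C → Cube a A C))
    -- R (identified with (r_n(A))_n) is closed in AR^ℕ
    closed     : ∀ (s : ℕ → AR) →
                 (∀ n → Σ R λ A → (∀ k → k ≤ n → r A k ≡ s k)) →
                 Σ R λ A → (∀ n → r A n ≡ s n)

module _ (S : WA2Space) where
  open WA2Space S

  ARCountable : Set
  ARCountable = Σ (ℕ → AR) λ f → (∀ (a : AR) → ∃[ n ] f n ≡ a)

  -- closed subsets of R × ℕ^ℕ (product of the first-difference metric
  -- topology on R and the Baire space topology): the complement is open.
  ClosedRB : (R → (ℕ → ℕ) → Set) → Set
  ClosedRB C = ∀ A y → ¬ C A y →
               ∃[ n ] (∀ B z → (∀ k → k < n → r B k ≡ r A k) →
                                (∀ k → k < n → z k ≡ y k) → ¬ C B z)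

  Analytic : (R → Set) → Set₁
  Analytic X = Σ (R → (ℕ → ℕ) → Set) λ C → (ClosedRB C × (∀ A → X A ⇔ (∃[ y ] C A y)))

  -- Kastanas game K[a,A].
  -- A play: I's moves As n = A_n, II's moves as n = a_{n+1}, Bs n = B_n.
  module Play (a : AR) (A : R) (As : ℕ → R) (as : ℕ → AR) (Bs : ℕ → R) where
    aSeq : ℕ → AR
    aSeq zero    = a
    aSeq (suc n) = as n
    prevB : ℕ → R
    prevB zero    = A
    prevB (suc n) = Bs n

    I-legal : ℕ → Set
    I-legal n = Cube (aSeq n) (prevB n) (As n)

    II-legal : ℕ → Set
    II-legal n = (∃[ k ] (InAR k (aSeq n) × rCube (suc k) (aSeq n) (As n) (as n)))
                 × Cube (as n) (As n) (Bs n)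

    IsOutcome : R → Set
    IsOutcome B = ∃[ k ] (InAR k a × (∀ n → r B (k + n) ≡ aSeq n))

  -- I has a strategy in K[a,A] ensuring the outcome lies in Y.
  -- A strategy for I maps the list of II's previous moves to I's next move.
  IWins : AR → R → (R → Set) → Set
  IWins a A Y =
    Σ (List (AR × R) → R) λ σ → ∀ (as : ℕ → AR) (Bs : ℕ → R) →
      let As : ℕ → R
          As n = σ (applyUpTo (λ k → as k , Bs k) n)
          open Play a A As as Bs
      in (∀ n → (∀ k → k < n → II-legal k) → I-legal n)
       × ((∀ n → II-legal n) → ∃[ B ] (IsOutcome B × Y B))

  -- II has a strategy in K[a,A] ensuring the outcome lies in Y.
  -- A strategy for II maps the list of I's moves so far (including the
  -- current one) to II's reply (a_{n+1}, B_n).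
  IIWins : AR → R → (R → Set) → Set
  IIWins a A Y =
    Σ (List R → AR × R) λ τ → ∀ (As : ℕ → R) →
      let as : ℕ → AR
          as n = Data.Product.proj₁ (τ (applyUpTo As (suc n)))
          Bs : ℕ → R
          Bs n = Data.Product.proj₂ (τ (applyUpTo As (suc n)))
          open Play a A As as Bs
      in (∀ n → (∀ k → k ≤ n → I-legal k) → II-legal n)
       × ((∀ n → I-legal n) → ∃[ B ] (IsOutcome B × Y B))

  KastanasRamsey : (R → Set) → Set
  KastanasRamsey X =
    ∀ A a → ARr A a →
      ∃[ B ] (Cube a A B ×
              (IWins a B (λ C → ¬ X C) ⊎ IIWins a B X))

{-# OPTIONS --safe #-}
module Submission where

-- Unfold X as the projection of a closed C ⊆ R × ℕ^ℕ and write X_s for the set of E with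
-- C E z for some z extending the finite sequence s, so that X_s is the union of the X_{s m}.
-- Call (a , A) bad for s if I cannot avoid X_s in K[a,A].
-- If (a , A) is bad for s, then II can force a position that is bad for some s m. Otherwise
-- I can play so that no such position is ever reached, even when II shrinks her last B; I
-- then picks up, one per round, strategies avoiding X_{s 0}, X_{s 1}, … and runs them all at
-- once, feeding each the answer of the previous one as if II had played it. This avoids X_s.
-- So if (a , A) is bad for the empty sequence, II can keep extending s through bad
-- positions. The limit y of the s satisfies C E y for the outcome E: otherwise closedness
-- makes some position of the play miss X_s, and such a position is not bad.

open import Defs
open import Level using (0ℓ)
open import Axiom.ExcludedMiddle using (ExcludedMiddle)
open import Data.List using (List; []; _∷_; _++_; _∷ʳ_; length; foldl; applyUpTo)
open import Data.List.Properties using (applyUpTo-∷ʳ; foldl-∷ʳ; ++-assoc; ++-identityʳ)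
open import Data.Nat using (ℕ; zero; _+_; _∸_; _≤_; _<_; z≤n; s≤s; _≟_; _<′_; <′-base; ≤′-step)
open import Data.Nat.Induction using (<-rec)
open import Data.Nat.Properties
open import Data.Product using (Σ; ∃-syntax; _×_; _,_; proj₁; proj₂)
open import Data.Sum using (_⊎_; inj₁; inj₂)
open import Data.Unit using (⊤; tt)
open import Function.Bundles using (Equivalence)
open import Relation.Nullary using (¬_; yes; no; contradiction; decidable-stable)
open import Relation.Binary.PropositionalEquality

-- Histories and iterated state transitions

trajectory : {State Move : Set} → (State → Move → State) → State → (ℕ → Move) → ℕ → State
trajectory g t f zero      = t
trajectory g t f (ℕ.suc n) = g (trajectory g t f n) (f n)

-- A strategy sees its history as a list and folds over it from the front, while a play grows at its
-- end. This lemma lets rounds be treated by recursion on their number.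
foldl-trajectory : {State Move : Set} (g : State → Move → State) (t : State) (f : ℕ → Move) →
                   ∀ n → foldl g t (applyUpTo f n) ≡ trajectory g t f n
foldl-trajectory g t f zero = refl
foldl-trajectory g t f (ℕ.suc n) = begin
  foldl g t (applyUpTo f (ℕ.suc n))  ≡⟨ cong (foldl g t) (applyUpTo-∷ʳ f n) ⟨
  foldl g t (applyUpTo f n ∷ʳ f n)   ≡⟨ foldl-∷ʳ g t (f n) (applyUpTo f n) ⟩
  g (foldl g t (applyUpTo f n)) (f n)  ≡⟨ cong (λ u → g u (f n)) (foldl-trajectory g t f n) ⟩
  g (trajectory g t f n) (f n)       ∎
  where open ≡-Reasoning

-- Approximations, cubes and legal moves

module KastanasGame (em : ExcludedMiddle 0ℓ) (S : WA2Space) where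
  open Data.Nat using (suc)
  open WA2Space S

  stable : {P : Set} → ¬ ¬ P → P
  stable = decidable-stable em

  private variable
    a a' : AR
    A A' B D E E' : R
    Y Z : R → Set

  -- At position `a`, with I having played `A`, II answers `a'` and `B`.
  Legal : AR → R → AR → R → Set
  Legal a A a' B = (∃[ k ] (InAR k a × rCube (suc k) a A a')) × Cube a' A B

  r-agree : ∀ {n m} → r A n ≡ r B m → ∀ {k} → k ≤ n → r A k ≡ r B k
  r-agree {A} {B} {n} {m} eq k≤n with A1-3 A B n m eq | m≤n⇒m<n∨m≡n k≤n
  ... | refl , below | inj₁ k<n  = below _ k<n
  ... | refl , below | inj₂ refl = eq

  InAR-unique : ∀ {n m} → InAR n a → InAR m a → n ≡ m
  InAR-unique (A , p) (B , q) = proj₁ (A1-3 A B _ _ (trans p (sym q)))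

  r-injective : (∀ n → r A n ≡ r B n) → A ≡ B
  r-injective {A} {B} same = stable λ A≢B →
    let n , differ = A1-2 A B A≢B in differ (same n)

  ARr-mono : A ≤R B → ARr A a → ARr B a
  ARr-mono {A} {B} A≤B (n , a≤) =
    let m , ≤m = Equivalence.to (wA2-2 A B) A≤B n in m , ≤fin-trans a≤ ≤m

  Cube-mono : A ≤R B → Cube a A D → Cube a B D
  Cube-mono A≤B (D≤A , init) = ≤R-trans D≤A A≤B , init

  Legal-mono : A ≤R A' → Legal a A a' B → Legal a A' a' B
  Legal-mono A≤ ((k , ak , arr , ⊑ , ak') , cube) =
    (k , ak , ARr-mono A≤ arr , ⊑ , ak') , Cube-mono A≤ cube

  Legal-shrink : Legal a A a' B → Cube a' B D → Legal a A a' D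
  Legal-shrink (pos , (B≤A , _)) cube = pos , Cube-mono B≤A cube

  -- Existence and uniqueness of outcomes

  Outcome : (ℕ → AR) → R → Set
  Outcome s E = ∃[ k ] (InAR k (s 0) × (∀ n → r E (k + n) ≡ s n))

  outcome-unique : ∀ {s : ℕ → AR} {k k'} → (∀ n → r E (k + n) ≡ s n) → (∀ n → r E' (k' + n) ≡ s n) → E ≡ E'
  outcome-unique {k = k} p q =
    r-injective λ n → r-agree (trans (p n) (sym (q n))) (m≤n+m n k)

  -- Each `s n` is the approximation at level `k + n` of some `P n`. Consecutive `P n` agree up to
  -- that level, so their diagonal is approximated by members of `R`, and closedness gives the
  -- limit.
  outcome-exists : (s : ℕ → AR) →
    (∀ n → ∃[ k ] (InAR k (s n) × s n ⊑ s (suc n) × InAR (suc k) (s (suc n)))) →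
    ∃[ E ] Outcome s E
  outcome-exists s chain = proj₁ limit , k , proj₁ (proj₂ (chain 0)) , λ n →
      trans (proj₂ limit (k + n)) (trans (sym (P-agree≤ (m≤n+m n k) ≤-refl)) (P-spec n))
    where
    k = proj₁ (chain 0)

    height : ∀ n → InAR (k + n) (s n)
    height zero    = subst (λ i → InAR i (s 0)) (sym (+-identityʳ k)) (proj₁ (proj₂ (chain 0)))
    height (suc n) =
      let k' , here , _ , above = chain n
      in subst (λ i → InAR i (s (suc n)))
           (trans (cong suc (InAR-unique here (height n))) (sym (+-suc k n))) above

    P : ℕ → R
    P n = proj₁ (height n)

    P-spec : ∀ n → r (P n) (k + n) ≡ s n
    P-spec n = proj₂ (height n)

    P-agree : ∀ n {j} → j ≤ k + n → r (P n) j ≡ r (P (suc n)) j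
    P-agree n j≤ with proj₁ (proj₂ (proj₂ (chain n)))
    ... | A , m , m' , m≤m' , p , q =
      -- The common end-extension `A` witnessing `s n ⊑ s (suc n)` mediates between `P n` and
      -- `P (suc n)`.
      trans (r-agree eq j≤)
            (r-agree (trans q (sym (P-spec (suc n)))) (≤-trans (≤-trans j≤ (≤-reflexive k+n≡m)) m≤m'))
      where
      eq = trans (P-spec n) (sym p)
      k+n≡m = proj₁ (A1-3 _ _ _ _ eq)

    P-agree+ : ∀ i d {j} → j ≤ k + i → r (P i) j ≡ r (P (d + i)) j
    P-agree+ i zero    j≤ = refl
    P-agree+ i (suc d) j≤ =
      trans (P-agree+ i d j≤) (P-agree (d + i) (≤-trans j≤ (+-monoʳ-≤ k (m≤n+m i d))))

    P-agree≤ : ∀ {i n j} → i ≤ n → j ≤ k + i → r (P i) j ≡ r (P n) j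
    P-agree≤ {i} {n} {j} i≤n j≤ =
      subst (λ x → r (P i) j ≡ r (P x) j) (m∸n+n≡m i≤n) (P-agree+ i (n ∸ i) j≤)

    limit = closed (λ j → r (P j) j) λ n → P n , λ j j≤n → sym (P-agree≤ j≤n (m≤n+m j k))

  legal-outcome : (s : ℕ → AR) (D E : ℕ → R) → (∀ n → Legal (s n) (D n) (s (suc n)) (E n)) →
                  ∃[ F ] Outcome s F
  legal-outcome s D E legal = outcome-exists s λ n →
    let (k , here , _ , ⊑ , above) , _ = legal n in k , here , ⊑ , above

  -- Winning strategies of I and their residuals

  IWins-outcome : (W : IWins S a A Y) (as : ℕ → AR) (Bs : ℕ → R) →
    (let As = λ n → proj₁ W (applyUpTo (λ k → as k , Bs k) n)) →
    (∀ n → Play.II-legal S a A As as Bs n) →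
    ∀ k → (∀ n → r E (k + n) ≡ Play.aSeq S a A As as Bs n) → Y E
  IWins-outcome {a = a} {A = A} {Y = Y} (σ , win) as Bs legal k follows =
    let E' , (k' , _ , follows') , y = proj₂ (win as Bs) legal
    -- The strategy promises only some outcome in `Y`; outcomes are unique, so it is `E`.
    in subst Y (outcome-unique {s = aSeq} follows' follows) y
    where open Play S a A (λ n → σ (applyUpTo (λ k → as k , Bs k) n)) as Bs using (aSeq)

  IWins-mono : (∀ E → Y E → Z E) → IWins S a A Y → IWins S a A Z
  IWins-mono Y⊆Z (σ , win) = σ , λ as Bs →
    proj₁ (win as Bs) , λ legal →
      let E , out , y = proj₂ (win as Bs) legal in E , out , Y⊆Z E y

  IWins-first : (W : IWins S a A Y) → Cube a A (proj₁ W [])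
  IWins-first {a} {A} (σ , win) = proj₁ (win (λ _ → a) (λ _ → A)) 0 λ _ ()

  Await : AR → R → (R → Set) → Set
  Await a A Y = ∀ a' B → Legal a A a' B → IWins S a' B Y

  -- A smaller move of I leaves II fewer legal replies.
  Await-anti : A ≤R A' → Await a A' Y → Await a A Y
  Await-anti A≤ w a' B l = w a' B (Legal-mono A≤ l)

  -- Prepending II's reply to every history turns a play from the new position into a play of the
  -- original game.
  IWins-next : (W : IWins S a A Y) → Await a (proj₁ W []) Y
  IWins-next {a} {A} {Y} (σ , win) a' B l = (λ h → σ ((a' , B) ∷ h)) , λ as Bs → legality as Bs , outcome as Bs
    where
    module _ (as : ℕ → AR) (Bs : ℕ → R) where
      module P = Play S a' B (λ n → σ ((a' , B) ∷ applyUpTo (λ k → as k , Bs k) n)) as Bs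
      whole = win P.aSeq P.prevB
      module Q = Play S a A (λ n → σ (applyUpTo (λ k → P.aSeq k , P.prevB k) n)) P.aSeq P.prevB

      extend : ∀ n → (∀ k → k < n → P.II-legal k) → ∀ k → k < suc n → Q.II-legal k
      extend n ls zero    _         = l
      extend n ls (suc k) (s≤s k<n) = ls k k<n

      legality : ∀ n → (∀ k → k < n → P.II-legal k) → P.I-legal n
      legality n ls = proj₁ whole (suc n) (extend n ls)

      outcome : (∀ n → P.II-legal n) → ∃[ E ] (P.IsOutcome E × Y E)
      outcome ls with proj₂ whole (λ n → extend n (λ k _ → ls k) n ≤-refl)
      ... | E , (k , ak , follows) , y =
        E , (suc k , a'-height , λ n → trans (cong (r E) (sym (+-suc k n))) (follows (suc n))) , y
        where
        a'-height : InAR (suc k) a'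
        a'-height = let k' , ak' , _ , _ , above = proj₁ l
                    in subst (λ i → InAR (suc i) a') (InAR-unique ak' ak) above

  -- By coherence each `W (suc i)` is the residual of `W i` after one reply, so the sequence is a
  -- single infinite play by `W 0`.
  follow-wins : (s : ℕ → AR) (D : ℕ → R) (W : ∀ i → IWins S (s i) (D i) Y) →
    (∀ i h → proj₁ (W (suc i)) h ≡ proj₁ (W i) ((s (suc i) , D (suc i)) ∷ h)) →
    (∀ i → Legal (s i) (proj₁ (W i) []) (s (suc i)) (D (suc i))) →
    ∀ k → (∀ n → r E (k + n) ≡ s n) → Y E
  follow-wins s D W coherent legal k follows =
    IWins-outcome (W 0) as Bs
      (λ n → subst₂ (λ b F → Legal b F (as n) (Bs n)) (sym (aSeq≡ n)) (sym (moves n)) (legal n))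
      k (λ n → trans (follows n) (sym (aSeq≡ n)))
    where
    as = λ i → s (suc i)
    Bs = λ i → D (suc i)
    f  = λ i → as i , Bs i
    open Play S (s 0) (D 0) (λ n → proj₁ (W 0) (applyUpTo f n)) as Bs using (aSeq)

    aSeq≡ : ∀ n → aSeq n ≡ s n
    aSeq≡ zero    = refl
    aSeq≡ (suc n) = refl

    moves+ : ∀ n h → proj₁ (W 0) (applyUpTo f n ++ h) ≡ proj₁ (W n) h
    moves+ zero    h = refl
    moves+ (suc n) h = begin
      proj₁ (W 0) (applyUpTo f (suc n) ++ h)            ≡⟨ cong (λ l → proj₁ (W 0) (l ++ h)) (applyUpTo-∷ʳ f n) ⟨
      proj₁ (W 0) ((applyUpTo f n ++ (f n ∷ [])) ++ h)  ≡⟨ cong (proj₁ (W 0)) (++-assoc (applyUpTo f n) _ h) ⟩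
      proj₁ (W 0) (applyUpTo f n ++ (f n ∷ h))          ≡⟨ moves+ n (f n ∷ h) ⟩
      proj₁ (W n) (f n ∷ h)                             ≡⟨ coherent n h ⟨
      proj₁ (W (suc n)) h                               ∎
      where
      open ≡-Reasoning

    moves : ∀ n → proj₁ (W 0) (applyUpTo f n) ≡ proj₁ (W n) []
    moves n = trans (cong (proj₁ (W 0)) (sym (++-identityʳ (applyUpTo f n)))) (moves+ n [])

  -- Strategies of I driven by a state with position `pa` and pending move `pA`

  module Machine (State : Set) (pa : State → AR) (pA : State → R)
    (next   : ∀ t a' B → Legal (pa t) (pA t) a' B → State)
    (next-a : ∀ t a' B l → pa (next t a' B l) ≡ a')
    (next-A : ∀ t a' B l → Cube a' B (pA (next t a' B l))) where

    next? : State → AR × R → State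
    next? t (a' , B) with em {Legal (pa t) (pA t) a' B}
    ... | yes l = next t a' B l
    -- Illegal replies of II leave the state as it is; no winning condition concerns them.
    ... | no _  = t

    -- The proof of legality is existential because `next` depends on it and `next?` uses the one
    -- supplied by excluded middle.
    Step : State → State → AR → R → Set
    Step t u a' B = Σ (Legal (pa t) (pA t) a' B) λ l → u ≡ next t a' B l

    next?-step : ∀ t a' B → Legal (pa t) (pA t) a' B → Step t (next? t (a' , B)) a' B
    next?-step t a' B l with em {Legal (pa t) (pA t) a' B}
    ... | yes l' = l' , refl
    ... | no ¬l  = contradiction l ¬l

    machine-wins : ∀ t₀ → Cube (pa t₀) A (pA t₀) →
      (∀ (t : ℕ → State) → t 0 ≡ t₀ → (∀ n → ∃[ a' ] ∃[ B ] Step (t n) (t (suc n)) a' B) →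
        ∀ k {E} → (∀ n → r E (k + n) ≡ pa (t n)) → Y E) →
      IWins S (pa t₀) A Y
    machine-wins {A} {Y} t₀ cube₀ good =
      (λ h → pA (foldl next? t₀ h)) , λ as Bs → legality as Bs , outcome as Bs
      where
      module _ (as : ℕ → AR) (Bs : ℕ → R) where
        f : ℕ → AR × R
        f k = as k , Bs k

        open Play S (pa t₀) A (λ n → pA (foldl next? t₀ (applyUpTo f n))) as Bs

        t : ℕ → State
        t = trajectory next? t₀ f

        fold≡ : ∀ n → foldl next? t₀ (applyUpTo f n) ≡ t n
        fold≡ = foldl-trajectory next? t₀ f

        step : ∀ n → II-legal n → pa (t n) ≡ aSeq n → Step (t n) (t (suc n)) (as n) (Bs n)
        step n l eq = next?-step (t n) (as n) (Bs n)
          (subst₂ (λ b F → Legal b F (as n) (Bs n)) (sym eq) (cong pA (fold≡ n)) l)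

        pa≡ : ∀ n → (∀ k → k < n → II-legal k) → pa (t n) ≡ aSeq n
        pa≡ zero    ls = refl
        pa≡ (suc n) ls =
          let l , eq = step n (ls n ≤-refl) (pa≡ n λ k k<n → ls k (m<n⇒m<1+n k<n))
          in trans (cong pa eq) (next-a _ _ _ l)

        legality : ∀ n → (∀ k → k < n → II-legal k) → I-legal n
        legality zero    ls = cube₀
        legality (suc n) ls =
          let l , eq = step n (ls n ≤-refl) (pa≡ n λ k k<n → ls k (m<n⇒m<1+n k<n))
          in subst (λ u → Cube (as n) (Bs n) (pA u)) (sym (trans (fold≡ (suc n)) eq)) (next-A _ _ _ l)

        outcome : (∀ n → II-legal n) → ∃[ E ] (IsOutcome E × Y E)
        outcome ls =
          let E , out = legal-outcome aSeq _ Bs ls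
              k , _ , follows = out
              pa≡' = λ n → pa≡ n λ k _ → ls k
          in E , out , good t refl (λ n → as n , Bs n , step n (ls n) (pa≡' n)) k
                         (λ n → trans (follows n) (sym (pa≡' n)))

  -- I copies II's last `B` throughout; every outcome starts with `a`.
  IWins-trivial : Cube a A A → (∀ {E k} → r E k ≡ a → Y E) → IWins S a A Y
  IWins-trivial {a} {A} {Y} cube all = machine-wins (a , A) cube
    λ { t refl _ k follows → all (follows 0) }
    where
    open Machine (AR × R) proj₁ proj₂ (λ _ a' B _ → a' , B) (λ _ _ _ _ → refl)
           (λ _ _ B l → ≤R-refl B , proj₂ (proj₂ l))

  -- Winning countably many games at once

  module Union (Y : ℕ → R → Set) where

    data Reach (a : AR) (A : R) : Set where
      reach : (∀ A' → Cube a A A' → ∃[ a' ] ∃[ B ] (Legal a A' a' B ×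
                ((∃[ m ] ¬ IWins S a' B (Y m)) ⊎ Reach a' B))) → Reach a A

    Avoid : AR → R → Set
    Avoid a A = ∀ a' B → Legal a A a' B → ¬ Reach a' B × (∀ m → IWins S a' B (Y m))

    avoid : ¬ Reach a A → ∃[ D ] (Cube a A D × Avoid a D)
    avoid {a} {A} ¬reach = stable λ ¬move → ¬reach (reach λ A' cube →
      stable λ ¬reply → ¬move (A' , cube , λ a' B l →
        (λ re → ¬reply (a' , B , l , inj₂ re)) ,
        (λ m → stable λ ¬wins → ¬reply (a' , B , l , inj₁ (m , ¬wins)))))

    -- A stack of strategies for the first `k` targets, all waiting for a reply to the same move
    -- `A`.
    Sims : AR → R → ℕ → Set
    Sims a A zero    = ⊤
    Sims a A (suc k) = Sims a A k × Await a A (Y k)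

    Sims-anti : ∀ k → A ≤R A' → Sims a A' k → Sims a A k
    Sims-anti zero    A≤ _        = tt
    Sims-anti (suc k) A≤ (ss , w) = Sims-anti k A≤ ss , Await-anti A≤ w

    -- `<′` descends from the top of the stack, so its proof is the path to the strategy for `Y m`.
    get : ∀ {m k} → m <′ k → Sims a A k → Await a A (Y m)
    get <′-base     (ss , w) = w
    get (≤′-step p) (ss , w) = get p ss

    -- The simulated strategies answer in turn, each one being told that II played
    -- the answer of the previous one.
    advance : ∀ k → Sims a A k → Legal a A a' B → ∃[ E ] (Cube a' B E × Sims a' E k)
    advance {B = B} zero ss (_ , (_ , init)) = B , (≤R-refl B , init) , tt
    advance (suc k) (ss , w) l =
      let D , cube , ss' = advance k ss l
          W     = w _ D (Legal-shrink l cube)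
          cube' = IWins-first W
      in proj₁ W [] , Cube-mono (proj₁ cube) cube' ,
         (Sims-anti k (proj₁ cube') ss' , IWins-next W)

    -- One round seen by the strategy for `Y m`: it is told that II played `belief`, the actual move
    -- `E` lies below its answer, and `ss'` holds its residual.
    record Simulated {m k} (p : m <′ k) (ss : Sims a A k) (a' : AR) (E : R) (ss' : Sims a' E k) : Set where
      field
        belief   : R
        legal    : Legal a A a' belief
      wins : IWins S a' belief (Y m)
      wins = get p ss a' belief legal
      field
        below    : E ≤R proj₁ wins []
        coherent : ∀ a'' B l h → proj₁ (get p ss' a'' B l) h ≡ proj₁ wins ((a'' , B) ∷ h)

    get-Sims-anti : ∀ {m k} (p : m <′ k) (A≤ : A ≤R A') (ss : Sims a A' k) a' B l →
      get p (Sims-anti k A≤ ss) a' B l ≡ get p ss a' B (Legal-mono A≤ l)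
    get-Sims-anti <′-base     A≤ ss a' B l = refl
    get-Sims-anti (≤′-step p) A≤ (ss , _) a' B l = get-Sims-anti p A≤ ss a' B l

    simulate : ∀ {m k} (p : m <′ k) (ss : Sims a A k) (l : Legal a A a' B) →
      Simulated p ss a' (proj₁ (advance k ss l)) (proj₂ (proj₂ (advance k ss l)))
    simulate {k = suc k} <′-base (ss , w) l = record
      { belief   = proj₁ (advance k ss l)
      ; legal    = Legal-shrink l (proj₁ (proj₂ (advance k ss l)))
      ; below    = ≤R-refl _
      ; coherent = λ a'' B l h → refl
      }
    simulate {k = suc k} (≤′-step p) (ss , w) l = record
      { belief   = belief
      ; legal    = legal
      ; below    = ≤R-trans (proj₁ (IWins-first (w _ _ (Legal-shrink l (proj₁ (proj₂ (advance k ss l))))))) below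
      ; coherent = λ a'' B l'' h →
          trans (cong (λ W → proj₁ W h) (get-Sims-anti p _ _ a'' B l'')) (coherent a'' B _ h)
      }
      where open Simulated (simulate p ss l)

    record State : Set where
      field
        pa    : AR
        pA    : R
        age   : ℕ
        avoiding : Avoid pa pA
        sims  : Sims pa pA age
      allSims : Sims pa pA (suc age)
      -- One strategy joins per round, so the stack stays finite and every index is eventually
      -- covered.
      allSims = sims , λ a' B l → proj₂ (avoiding a' B l) age
    open State

    module _ (t : State) (a' : AR) (B : R) (l : Legal (pa t) (pA t) a' B) where
      -- I first shrinks `B` so that II still cannot get into `Reach`, then lets the stack shrink it
      -- further; the first property survives shrinking.
      avoider = avoid (proj₁ (avoiding t a' B l))

      legal-avoider : Legal (pa t) (pA t) a' (proj₁ avoider)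
      legal-avoider = Legal-shrink l (proj₁ (proj₂ avoider))

      advanced = advance (suc (age t)) (allSims t) legal-avoider

      next : State
      next = record
        { pa = a' ; pA = proj₁ advanced ; age = suc (age t)
        ; avoiding = λ a'' B' l' → proj₂ (proj₂ avoider) a'' B' (Legal-mono (proj₁ (proj₁ (proj₂ advanced))) l')
        ; sims = proj₂ (proj₂ advanced) }

      next-cube : Cube a' B (pA next)
      next-cube = Cube-mono (proj₁ (proj₁ (proj₂ avoider))) (proj₁ (proj₂ advanced))

    open Machine State pa pA next (λ _ _ _ _ → refl) next-cube

    record Tracked {m : ℕ} (t u : State) (before : m <′ suc (age t)) : Set where
      field
        after  : m <′ suc (age u)
        belief : R
        legal  : Legal (pa t) (pA t) (pa u) belief
      wins : IWins S (pa u) belief (Y m)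
      wins = get before (allSims t) (pa u) belief legal
      field
        below  : pA u ≤R proj₁ wins []
        coherent : ∀ a'' B l h → proj₁ (get after (allSims u) a'' B l) h ≡ proj₁ wins ((a'' , B) ∷ h)

    track : ∀ {m t u a' B} (p : m <′ suc (age t)) → Step t u a' B → Tracked t u p
    track {t = t} {a' = a'} {B} p (l , refl) = record
      { after = ≤′-step p ; belief = belief ; legal = legal
      ; below = below ; coherent = coherent }
      where open Simulated (simulate p (allSims t) (legal-avoider t a' B l))

    -- For each `m`, a tail of the actual play is a play by the strategy for `Y m` with the same
    -- outcome.
    ¬Reach⇒IWins : ¬ Reach a A → IWins S a A (λ E → ∀ m → Y m E)
    ¬Reach⇒IWins {a} {A} ¬reach = machine-wins start (proj₁ (proj₂ first)) good
      where
      first = avoid ¬reach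

      start : State
      start = record { pa = a ; pA = proj₁ first ; age = 0 ; avoiding = proj₂ (proj₂ first) ; sims = tt }

      good : ∀ (t : ℕ → State) → t 0 ≡ start → (∀ n → ∃[ a' ] ∃[ B ] Step (t n) (t (suc n)) a' B) →
             ∀ k {E} → (∀ n → r E (k + n) ≡ pa (t n)) → ∀ m → Y m E
      good t t0≡ steps k {E} follows m =
        follow-wins (λ i → pa (t (suc i + m))) (λ i → Tracked.belief (tr i)) (λ i → Tracked.wins (tr i))
          (λ i h → Tracked.coherent (tr i) _ _ _ h)
          -- The actual move is below the strategy's own answer, so replies legal against the former
          -- are legal against the latter.
          (λ i → Legal-mono (Tracked.below (tr i)) (Tracked.legal (tr (suc i))))
          -- The strategy for `Y m` joins at `t m` and takes over after II's next reply, at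
          -- `t (suc m)`.
          (k + suc m) (λ n → trans (cong (r E) (index n)) (follows (suc n + m)))
        where
        age≡ : ∀ n → age (t n) ≡ n
        age≡ zero    = cong age t0≡
        age≡ (suc n) = let _ , _ , _ , eq = steps n in trans (cong age eq) (cong suc (age≡ n))

        pointer : ∀ i → m <′ suc (age (t (i + m)))
        tr : ∀ i → Tracked (t (i + m)) (t (suc i + m)) (pointer i)

        pointer zero    = subst (λ x → m <′ suc x) (sym (age≡ m)) <′-base
        pointer (suc i) = Tracked.after (tr i)
        tr i = track (pointer i) (proj₂ (proj₂ (steps (i + m))))

        index : ∀ n → k + suc m + n ≡ k + (suc n + m)
        index n = trans (+-assoc k (suc m) n) (cong (λ x → k + suc x) (+-comm m n))

  -- Unfolding an analytic set: the strategy of II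

  module Unfolding (C : R → (ℕ → ℕ) → Set) (C-closed : ClosedRB S C) where

    -- Finite sequences are stored with their last entry first.
    look : List ℕ → ℕ → ℕ
    look []      i = 0
    look (m ∷ s) i with i ≟ length s
    ... | yes _ = m
    ... | no _  = look s i

    look-last : ∀ m s → look (m ∷ s) (length s) ≡ m
    look-last m s with length s ≟ length s
    ... | yes _ = refl
    ... | no ≢  = contradiction refl ≢

    look-init : ∀ m s {i} → i < length s → look (m ∷ s) i ≡ look s i
    look-init m s {i} i< with i ≟ length s
    ... | yes refl = contradiction i< (<-irrefl refl)
    ... | no _     = refl

    _≺_ : List ℕ → (ℕ → ℕ) → Set
    s ≺ z = ∀ i → i < length s → look s i ≡ z i

    ≺-extend : ∀ {s z} → s ≺ z → (z (length s) ∷ s) ≺ z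
    ≺-extend {s} {z} s≺z i (s≤s i≤) with m≤n⇒m<n∨m≡n i≤
    ... | inj₁ i<   = trans (look-init _ s i<) (s≺z i i<)
    ... | inj₂ refl = look-last _ s

    ≺-init : ∀ {m s z} → (m ∷ s) ≺ z → s ≺ z
    ≺-init {m} {s} ms≺z i i< = trans (sym (look-init m s i<)) (ms≺z i (m<n⇒m<1+n i<))

    Section : List ℕ → R → Set
    Section s E = ∃[ z ] (s ≺ z × C E z)

    Avoids : List ℕ → AR → R → Set
    Avoids s a A = IWins S a A (λ E → ¬ Section s E)

    module U (s : List ℕ) = Union (λ m E → ¬ Section (m ∷ s) E)
    open U using (Reach; reach)

    Reply : List ℕ → AR → R → Set
    Reply s a A = ∃[ a' ] ∃[ B ] (Legal a A a' B × ((∃[ m ] ¬ Avoids (m ∷ s) a' B) ⊎ Reach s a' B))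

    -- Any `z` extending `s` also extends `s` by its next entry, so avoiding all the one-step
    -- sections avoids `Section s`.
    ¬Avoids⇒Reach : ∀ s → ¬ Avoids s a A → Reach s a A
    ¬Avoids⇒Reach s ¬avoids = stable λ ¬reach → ¬avoids
      (IWins-mono (λ { E all (z , s≺z , c) → all (z (length s)) (z , ≺-extend s≺z , c) })
        (U.¬Reach⇒IWins s ¬reach))

    -- Playing I's supposed strategy against the tree leads to a leaf where its residual would avoid
    -- a smaller section, which the leaf forbids.
    Reach⇒¬Avoids : ∀ s → Reach s a A → ¬ Avoids s a A
    Reply⇒¬Await  : ∀ s → Reply s a A → ¬ Await a A (λ E → ¬ Section s E)

    Reach⇒¬Avoids s (reach f) W = Reply⇒¬Await s (f (proj₁ W []) (IWins-first W)) (IWins-next W)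

    Reply⇒¬Await s (a' , B , l , inj₁ (m , ¬avoids)) w = ¬avoids
      (IWins-mono (λ { E none (z , ms≺z , c) → none (z , ≺-init ms≺z , c) }) (w a' B l))
    Reply⇒¬Await s (a' , B , l , inj₂ re) w = Reach⇒¬Avoids s re (w a' B l)

    -- II remembers the sequence built so far and a tree in `Reach`, whose replies she plays.
    record State : Set where
      constructor state
      field
        code  : List ℕ
        pa    : AR
        pA    : R
        reaches : Reach code pa pA
    open State

    respond : ∀ s → Reply s a A → State
    -- At a leaf the sequence grows by `m` and a fresh tree is started.
    respond s (a' , B , l , inj₁ (m , ¬avoids)) = state (m ∷ s) a' B (¬Avoids⇒Reach (m ∷ s) ¬avoids)
    respond s (a' , B , l , inj₂ re)            = state s a' B re

    respond-legal : ∀ s (reply : Reply s a A) → Legal a A (pa (respond s reply)) (pA (respond s reply))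
    respond-legal s (_ , _ , l , inj₁ _) = l
    respond-legal s (_ , _ , l , inj₂ _) = l

    next : ∀ t A' → Cube (pa t) (pA t) A' → State
    next (state s a A (reach f)) A' cube = respond s (f A' cube)

    next? : State → R → State
    next? t A' with em {Cube (pa t) (pA t) A'}
    ... | yes cube = next t A' cube
    ... | no _     = t

    Step : State → State → R → Set
    Step t u A' = Σ (Cube (pa t) (pA t) A') λ cube → u ≡ next t A' cube

    next?-step : ∀ t A' → Cube (pa t) (pA t) A' → Step t (next? t A') A'
    next?-step t A' cube with em {Cube (pa t) (pA t) A'}
    ... | yes cube' = cube' , refl
    ... | no ¬cube  = contradiction cube ¬cube

    step-legal : ∀ t {u A'} → Step t u A' → Legal (pa t) A' (pa u) (pA u)
    step-legal (state s a A (reach f)) {A' = A'} (cube , refl) = respond-legal s (f A' cube)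

    step-code : ∀ t {u A'} → Step t u A' → code u ≡ code t ⊎ (∃[ m ] code u ≡ m ∷ code t)
    step-code (state s a A (reach f)) {A' = A'} (cube , refl) with f A' cube
    ... | _ , _ , _ , inj₁ (m , _) = inj₂ (m , refl)
    ... | _ , _ , _ , inj₂ _       = inj₁ refl

    module Run (t : ℕ → State) (code₀ : code (t 0) ≡ [])
               (init : Cube (pa (t 0)) (pA (t 0)) (pA (t 0)))
               (As : ℕ → R) (steps : ∀ n → Step (t n) (t (suc n)) (As n)) where

      s : ℕ → List ℕ
      s n = code (t n)

      Later : List ℕ → Set
      Later c = ∃[ n ] length c < length (s n)

      -- By induction on the tree: each round descends into a subtree until a leaf lengthens the
      -- sequence.
      progress : ∀ {c} (re : Reach c a A) n → t n ≡ state c a A re → Later c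
      progress-reply : ∀ {c} (reply : Reply c a A) n → t n ≡ respond c reply → Later c

      progress {c = c} (reach f) n eq = let cube , eq' = respond-from eq (steps n)
                                        in progress-reply (f (As n) cube) (suc n) eq'
        where
        respond-from : ∀ {t u} → t ≡ state c _ _ (reach f) → Step t u (As n) →
                       ∃[ cube ] u ≡ respond c (f (As n) cube)
        respond-from refl step = step

      progress-reply {c = c} (_ , _ , _ , inj₁ (m , _)) n eq =
        n , ≤-reflexive (cong (λ u → length (code u)) (sym eq))
      progress-reply (_ , _ , _ , inj₂ re) n eq = progress re n eq

      unbounded : ∀ N → ∃[ n ] N ≤ length (s n)
      unbounded zero    = 0 , z≤n
      unbounded (suc N) = let n , N≤ = unbounded N
                              n' , longer = progress (reaches (t n)) n refl
                          in n' , ≤-trans (s≤s N≤) longer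

      -- At most one entry is added per round, so a long sequence certifies that many rounds, hence
      -- a long approximation of the outcome.
      length-bound : ∀ n → length (s n) ≤ n
      length-bound zero = ≤-reflexive (cong length code₀)
      length-bound (suc n) with step-code (t n) (steps n)
      ... | inj₁ eq       = ≤-trans (≤-reflexive (cong length eq)) (m≤n⇒m≤1+n (length-bound n))
      ... | inj₂ (m , eq) = ≤-trans (≤-reflexive (cong length eq)) (s≤s (length-bound n))

      stays : ∀ {n i} d → i < length (s n) → i < length (s (d + n)) × look (s (d + n)) i ≡ look (s n) i
      stays zero i< = i< , refl
      stays {n} {i} (suc d) i< with stays {n} d i< | step-code (t (d + n)) (steps (d + n))
      ... | i<' , same | inj₁ eq rewrite eq       = i<' , same
      ... | i<' , same | inj₂ (m , eq) rewrite eq = m<n⇒m<1+n i<' , trans (look-init m (s (d + n)) i<') same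

      look-agree : ∀ {n n' i} → n ≤ n' → i < length (s n) → look (s n') i ≡ look (s n) i
      look-agree {n} {n'} {i} n≤n' i< =
        subst (λ x → look (s x) i ≡ look (s n) i) (m∸n+n≡m n≤n') (proj₂ (stays (n' ∸ n) i<))

      -- Entries never change once written, so any stage that has entry `i` gives the same value.
      y : ℕ → ℕ
      y i = look (s (proj₁ (unbounded (suc i)))) i

      s≺y : ∀ n → s n ≺ y
      s≺y n i i< with ≤-total n (proj₁ (unbounded (suc i)))
      ... | inj₁ n≤ = sym (look-agree n≤ i<)
      ... | inj₂ ≤n = look-agree ≤n (proj₂ (unbounded (suc i)))

      self-cube : ∀ n → Cube (pa (t n)) (pA (t n)) (pA (t n))
      self-cube zero    = init
      self-cube (suc n) = let _ , (_ , top) = step-legal (t n) (steps n) in ≤R-refl _ , top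

      -- Otherwise closedness separates (E , y) from C by some stage n, and then
      -- I avoids the section of s n for trivial reasons.
      outcome∈C : ∀ k {E} → (∀ n → r E (k + n) ≡ pa (t n)) → C E y
      outcome∈C k {E} follows = stable λ ¬c →
        let N , separated = C-closed E y ¬c
            n , N≤ = unbounded N
            N≤n = ≤-trans N≤ (length-bound n)
        in Reach⇒¬Avoids (s n) (reaches (t n)) (IWins-trivial (self-cube n)
             λ { {E'} eq (z , s≺z , c) → separated E' z
                   (λ i i<N → sym (r-agree (trans (follows n) (sym eq))
                                     (≤-trans (<⇒≤ (≤-trans i<N N≤n)) (m≤n+m n k))))
                   (λ i i<N → trans (sym (s≺z i (≤-trans i<N N≤))) (s≺y n i (≤-trans i<N N≤)))
                   c })

    IIWins-unfolded : Cube a A A → ¬ Avoids [] a A → IIWins S a A (λ E → ∃[ y ] C E y)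
    IIWins-unfolded {a} {A} init ¬avoids =
      (λ h → pa (foldl next? t₀ h) , pA (foldl next? t₀ h)) , λ As → legality As , outcome As
      where
      t₀ : State
      t₀ = state [] a A (¬Avoids⇒Reach [] ¬avoids)

      module _ (As : ℕ → R) where
        as : ℕ → AR
        as n = pa (foldl next? t₀ (applyUpTo As (suc n)))

        Bs : ℕ → R
        Bs n = pA (foldl next? t₀ (applyUpTo As (suc n)))

        open Play S a A As as Bs

        t : ℕ → State
        t = trajectory next? t₀ As

        fold≡ : ∀ n → foldl next? t₀ (applyUpTo As n) ≡ t n
        fold≡ = foldl-trajectory next? t₀ As

        aSeq≡ : ∀ n → aSeq n ≡ pa (t n)
        aSeq≡ zero    = refl
        aSeq≡ (suc n) = cong pa (fold≡ (suc n))

        prevB≡ : ∀ n → prevB n ≡ pA (t n)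
        prevB≡ zero    = refl
        prevB≡ (suc n) = cong pA (fold≡ (suc n))

        step : ∀ n → I-legal n → Step (t n) (t (suc n)) (As n)
        step n l = next?-step (t n) (As n) (subst₂ (λ b F → Cube b F (As n)) (aSeq≡ n) (prevB≡ n) l)

        II-legal-after : ∀ n → I-legal n → II-legal n
        II-legal-after n l = subst₂ (λ b u → Legal b (As n) (pa u) (pA u))
          (sym (aSeq≡ n)) (sym (fold≡ (suc n))) (step-legal (t n) (step n l))

        legality : ∀ n → (∀ k → k ≤ n → I-legal k) → II-legal n
        legality n ls = II-legal-after n (ls n ≤-refl)

        outcome : (∀ n → I-legal n) → ∃[ E ] (IsOutcome E × (∃[ y ] C E y))
        outcome ls =
          let E , out = legal-outcome aSeq As Bs (λ n → II-legal-after n (ls n))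
              k , _ , follows = out
          in E , out , Run.y t refl init As (λ n → step n (ls n)) ,
             Run.outcome∈C t refl init As (λ n → step n (ls n)) k (λ n → trans (follows n) (aSeq≡ n))

  -- Determinacy and the Kastanas Ramsey property

  IIWins-mono : (∀ E → Y E → Z E) → IIWins S a A Y → IIWins S a A Z
  IIWins-mono Y⊆Z (τ , win) = τ , λ As →
    proj₁ (win As) , λ legal →
      let E , out , y = proj₂ (win As) legal in E , out , Y⊆Z E y

  Least : (ℕ → Set) → Set
  Least P = ∃[ m ] (P m × (∀ k → k < m → ¬ P k))

  least : (P : ℕ → Set) → ∀ n → P n → Least P
  least P = <-rec (λ n → P n → Least P) search
    where
    search : ∀ n → (∀ {m} → m < n → P m → Least P) → P n → Least P
    search n smaller p with em {∃[ k ] (k < n × P k)}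
    ... | yes (k , k<n , q) = smaller k<n q
    ... | no none           = n , p , λ k k<n q → none (k , k<n , q)

  cube-nonempty : ARr A a → ∃[ B ] Cube a A B
  cube-nonempty {A} {a} (n , a≤) =
    let d , depth = least (λ m → a ≤fin r A m) n a≤
    -- `A` itself lies in the cube given by its approximation at level `d`.
    in A3-1 A a d depth A (≤R-refl A , d , refl)

  analytic-KastanasRamsey : ∀ {X} → Analytic S X → KastanasRamsey S X
  analytic-KastanasRamsey {X} (C , C-closed , X⇔) A a a∈A with cube-nonempty a∈A
  ... | B , cube = B , cube , determined
    where
    open Unfolding C C-closed

    determined : IWins S a B (λ E → ¬ X E) ⊎ IIWins S a B X
    determined with em {Avoids [] a B}
    ... | yes avoids = inj₁ (IWins-mono
            (λ E none x → let y , c = Equivalence.to (X⇔ E) x in none (y , (λ _ ()) , c)) avoids)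
    ... | no ¬avoids = inj₂ (IIWins-mono
            (λ E → Equivalence.from (X⇔ E)) (IIWins-unfolded (≤R-refl B , proj₂ cube) ¬avoids))

open import Level using (suc)

theorem1p2 : ExcludedMiddle 0ℓ → ExcludedMiddle (suc 0ℓ) →
    (S : WA2Space) → ARCountable S →
    (X : WA2Space.R S → Set) → Analytic S X → KastanasRamsey S X
theorem1p2 em _ S _ X analytic = KastanasGame.analytic-KastanasRamsey em S analytic
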